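{- Let $Q$ be a finite $3$-graph that is sparse and satisfies $\Delta_2(Q)\le 2$. Then $\lambda(\operatorname{cone}(Q))\le 4/9$.
   Context: A $3$-graph $H$ is a set of $3$-element subsets of a finite vertex set $V(H)$. For $\mathbf x=(x_i)_{i\in V(H)}$, the normalized Lagrangian polynomial is $p_H(\mathbf x)=6\sum_{ijk\in H}x_ix_jx_k$, and the normalized Lagrangian is $\lambda(H)=\max\{p_H(\mathbf x): x_i\ge 0,\ \sum_i x_i=1\}$. For distinct vertices $u,v$, $d_Q(u,v)=|\{w: uvw\in Q\}|$, and $\Delta_2(Q)=\max_{u\ne v}d_Q(u,v)$. $Q$ is sparse if for every $S\subseteq V(Q)$ with $|S|\ge 2$, the induced subgraph satisfies $|Q[S]|\le |S|-2$. The cone of $Q$ is the $3$-graph on $V(Q)\cup\{v_0\}$ ($v_0\notin V(Q)$ a new vertex) with edge set $Q\cup\{v_0uv: u,v\in V(Q),\ u\ne v\}$.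
   Formalization: The bound λ(cone(Q)) ≤ 4/9 is stated as p(x) ≤ 4/9 for every point x of the simplex with rational coordinates; the bound over real weights follows by density and continuity. -}

module Defs where

open import Data.Bool using (Bool; true; false; _∧_; _∨_; if_then_else_)
open import Data.Nat using (ℕ; zero; suc; _∸_; _≤_)
open import Data.Fin using (Fin; zero; suc; _<_)
open import Data.Fin.Properties using (_≟_; _<?_)
open import Data.Fin.Subset using (Subset; ∣_∣)
open import Data.Vec using (lookup)
open import Data.List using (List; []; _∷_; [_]; map; _++_; concatMap; length; filterᵇ; allFin; foldr)
open import Data.List.Relation.Unary.All using (All)
open import Data.List.Relation.Unary.Unique.Propositional using (Unique)
open import Data.Product using (_×_; _,_)
open import Data.Rational using (ℚ; 0ℚ; _+_; _*_; _/_)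
open import Data.Integer using (+_)
open import Relation.Nullary.Decidable using (⌊_⌋)
open import Relation.Binary.PropositionalEquality using (_≢_)

Triple : ℕ → Set
Triple n = Fin n × Fin n × Fin n

-- A triple represents the 3-set {i,j,k}; we use the canonical sorted representative.
Sorted : ∀ {n} → Triple n → Set
Sorted (i , j , k) = (i < j) × (j < k)

record ThreeGraph (n : ℕ) : Set where
  constructor mk3G
  field
    edges  : List (Triple n)
    sorted : All Sorted edges
    unique : Unique edges
open ThreeGraph public

inSubset : ∀ {n} → Subset n → Triple n → Bool
inSubset S (i , j , k) = lookup S i ∧ (lookup S j ∧ lookup S k)

inducedCount : ∀ {n} → List (Triple n) → Subset n → ℕ
inducedCount Q S = length (filterᵇ (inSubset S) Q)

hasVertex : ∀ {n} → Fin n → Triple n → Bool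
hasVertex u (i , j , k) = ⌊ i ≟ u ⌋ ∨ (⌊ j ≟ u ⌋ ∨ ⌊ k ≟ u ⌋)

-- codegree d_Q(u,v) = |{w : uvw ∈ Q}| = number of edges containing both u and v (u ≠ v)
codeg : ∀ {n} → List (Triple n) → Fin n → Fin n → ℕ
codeg Q u v = length (filterᵇ (λ e → hasVertex u e ∧ hasVertex v e) Q)

MaxCodegAtMost : ∀ {n} → List (Triple n) → ℕ → Set
MaxCodegAtMost {n} Q d = (u v : Fin n) → u ≢ v → codeg Q u v ≤ d

Sparse : ∀ {n} → List (Triple n) → Set
Sparse {n} Q = (S : Subset n) → 2 ≤ ∣ S ∣ → inducedCount Q S ≤ ∣ S ∣ ∸ 2

coneEdges : ∀ {n} → List (Triple n) → List (Triple (suc n))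
coneEdges {n} Q =
  map (λ { (i , j , k) → (suc i , suc j , suc k) }) Q
  ++ concatMap (λ u → concatMap (λ v → if ⌊ u <? v ⌋ then [ (zero , suc u , suc v) ] else []) (allFin n)) (allFin n)

sumℚ : List ℚ → ℚ
sumℚ = foldr _+_ 0ℚ

sumFin : ∀ {n} → (Fin n → ℚ) → ℚ
sumFin {n} f = sumℚ (map f (allFin n))

-- normalized Lagrangian polynomial p_H(x) = 6 Σ_{ijk ∈ H} x_i x_j x_k
lagPoly : ∀ {n} → List (Triple n) → (Fin n → ℚ) → ℚ
lagPoly H x = (+ 6 / 1) * sumℚ (map (λ { (i , j , k) → x i * x j * x k }) H)

{-# OPTIONS --safe #-}

-- Let a be the weight of the apex and yᵢ the other weights; put s = Σ yᵢ,
-- M = Σ yᵢ² and q = Σ yᵢ yⱼ yₖ over the edges of Q.  The cone polynomial is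
-- 3 a (s² - M) + 6 q, and maximising over a + s = 1 reduces the theorem to
-- 4 s q ≤ M (s² - M).  Let d = y_u + y_v be the sum of the two largest weights.
-- Sparsity, applied to the level sets of y, gives Σ min(yᵢ, yⱼ, yₖ) ≤ s - d.
-- If 4 M ≥ s², it is enough that yᵢ yⱼ yₖ ≤ y_u y_v min(yᵢ, yⱼ, yₖ).
-- If 4 M ≤ s², then by AM-GM
--   yᵢ yⱼ yₖ ≤ M (s² - M) / (4 s²) min(yᵢ, yⱼ, yₖ) + d / (4 M) (yᵢ² yⱼ² + yᵢ² yₖ² + yⱼ² yₖ²).
-- As every pair lies in at most two edges, the last brackets add up to at most
-- M² - Σ yᵢ⁴ ≤ M² (s² - M) / s², and the two contributions of d cancel.
module Submission where

open import Defs
open import Data.Bool using (Bool; true; false; _∧_; _∨_; if_then_else_)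
open import Data.Bool.Properties using (∨-zeroʳ; ∨-identityʳ)
open import Data.Empty using (⊥-elim)
open import Data.Fin as Fin using (Fin; zero; suc; punchIn; punchOut)
open import Data.Fin.Properties as Fin using (punchIn-punchOut; punchInᵢ≢i) renaming (_≟_ to _≟ᶠ_)
open import Data.Fin.Subset using (Subset; ∣_∣; _∈_)
open import Data.Fin.Subset.Properties using (x∈p∧x≢y⇒x∈p-y; x∈p⇒∣p-x∣<∣p∣)
open import Data.Integer as ℤ using (+_)
import Data.Integer.Properties as ℤ
open import Data.List using (List; []; _∷_; [_]; map; _++_; concatMap; length; filterᵇ; allFin)
import Data.List.Membership.Propositional as List
open import Data.List.Membership.Propositional.Properties using (∈-map⁺; ∈-allFin)
open import Data.List.Properties using (map-tabulate; map-∘)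
open import Data.List.Relation.Binary.Permutation.Propositional using (↭-sym)
open import Data.List.Relation.Binary.Permutation.Propositional.Properties using (∈-resp-↭)
open import Data.List.Relation.Unary.All as All using (All; []; _∷_)
open import Data.List.Relation.Unary.AllPairs using (AllPairs; []; _∷_)
open import Data.List.Relation.Unary.Any using (here; there)
open import Data.List.Relation.Unary.Linked.Properties using (Linked⇒AllPairs)
open import Data.Nat as ℕ using (ℕ; zero; suc)
open import Data.Nat.Coprimality as Coprime using (Coprime; 1-coprimeTo)
import Data.Nat.Properties as ℕ
open import Data.Product using (_×_; _,_; ∃; ∃₂)
open import Data.Rational
  using (ℚ; mkℚ; 0ℚ; 1ℚ; _+_; _*_; -_; _-_; _≤_; _<_; _/_; _⊓_; _⊔_; nonNegative; positive)
open import Data.Rational.Properties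
open import Data.Sum using (_⊎_; inj₁; inj₂)
open import Data.Vec as Vec using ([]; _∷_; lookup)
open import Data.Vec.Properties using (lookup∘tabulate; lookup⇒[]=)
open import Function using (_∘_; id)
open import Relation.Binary.Bundles using (DecTotalOrder)
open import Relation.Binary.Definitions using (tri<; tri≈; tri>)
open import Relation.Binary.PropositionalEquality hiding ([_])
open import Relation.Nullary using (Dec; yes; no)
open import Relation.Nullary.Decidable using (⌊_⌋; dec⇒maybe)
open import Tactic.RingSolver using (solve-∀)
open import Tactic.RingSolver.Core.AlmostCommutativeRing using (AlmostCommutativeRing; fromCommutativeRing)

-- Arithmetic and order of the rationals.

ring : AlmostCommutativeRing _ _
ring = fromCommutativeRing +-*-commutativeRing λ p → dec⇒maybe (0ℚ ≟ p)

# : ℕ → ℚ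
# n = + n / 1

¼ : ℚ
¼ = + 1 / 4

-- Turns a polynomial inequality into a certificate: the gap `r` is written as a combination of
-- visibly nonnegative terms, and the ring solver checks `p + r ≡ q`.
≤-gap : ∀ {p q} r → 0ℚ ≤ r → p + r ≡ q → p ≤ q
≤-gap {p} r 0≤r eq = subst₂ _≤_ (+-identityʳ p) eq (+-monoʳ-≤ p 0≤r)

0≤q-p : ∀ {p q} → p ≤ q → 0ℚ ≤ q - p
0≤q-p {p} {q} p≤q = subst (_≤ q - p) (+-inverseʳ p) (+-monoˡ-≤ (- p) p≤q)

0≤p+q : ∀ {p q} → 0ℚ ≤ p → 0ℚ ≤ q → 0ℚ ≤ p + q
0≤p+q = +-mono-≤

*-monoˡ-≤ : ∀ {r p q} → 0ℚ ≤ r → p ≤ q → r * p ≤ r * q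
*-monoˡ-≤ {r} 0≤r = *-monoˡ-≤-nonNeg r {{nonNegative 0≤r}}

*-mono-≤ : ∀ {p q r t} → 0ℚ ≤ p → 0ℚ ≤ t → p ≤ q → r ≤ t → p * r ≤ q * t
*-mono-≤ {t = t} 0≤p 0≤t p≤q r≤t =
  ≤-trans (*-monoˡ-≤ 0≤p r≤t) (*-monoʳ-≤-nonNeg t {{nonNegative 0≤t}} p≤q)

*-cancelˡ-≤ : ∀ {r p q} → 0ℚ < r → r * p ≤ r * q → p ≤ q
*-cancelˡ-≤ {r} 0<r = *-cancelˡ-≤-pos r {{positive 0<r}}

0≤p*q : ∀ {p q} → 0ℚ ≤ p → 0ℚ ≤ q → 0ℚ ≤ p * q
0≤p*q {p} 0≤p 0≤q = subst (_≤ p * _) (*-zeroʳ p) (*-monoˡ-≤ 0≤p 0≤q)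

0<p*q : ∀ {p q} → 0ℚ < p → 0ℚ < q → 0ℚ < p * q
0<p*q {p} 0<p 0<q = subst (_< p * _) (*-zeroʳ p) (*-monoʳ-<-pos p {{positive 0<p}} 0<q)

0≤p² : ∀ p → 0ℚ ≤ p * p
0≤p² p with ≤-total 0ℚ p
... | inj₁ 0≤p = 0≤p*q 0≤p 0≤p
... | inj₂ p≤0 = subst (0ℚ ≤_) (neg² p) (0≤p*q (neg-antimono-≤ p≤0) (neg-antimono-≤ p≤0))
  where
  neg² : ∀ p → - p * - p ≡ p * p
  neg² = solve-∀ ring

0≤# : ∀ n → 0ℚ ≤ # n
0≤# n = nonNegative⁻¹ (# n) {{normalize-nonNeg n 1}}

-- Polynomial inequalities: one edge, the two regimes of M, and the cone.

pairSquares : ℚ → ℚ → ℚ → ℚ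
pairSquares x y z = x * x * (y * y) + (x * x * (z * z) + y * y * (z * z))

module _ {x y z d : ℚ} (0≤x : 0ℚ ≤ x) (0≤y : 0ℚ ≤ y) (0≤z : 0ℚ ≤ z) (x+y≤d : x + y ≤ d) where

  private
    0≤S : 0ℚ ≤ pairSquares x y z
    0≤S = 0≤p+q (0≤p*q (0≤p² x) (0≤p² y))
            (0≤p+q (0≤p*q (0≤p² x) (0≤p² z)) (0≤p*q (0≤p² y) (0≤p² z)))
    0≤x+y : 0ℚ ≤ x + y
    0≤x+y = 0≤p+q 0≤x 0≤y

  -- The right side minus the left is affine in P = x y ∈ [0, (x + y)² / 4]
  -- and nonnegative at both ends.
  16Pz≤3[x+y][P+2z²] :
    # 16 * (x * y) * z ≤ # 3 * (x + y) * (x * y + # 2 * (z * z))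
  16Pz≤3[x+y][P+2z²] with ≤-total (# 16 * z) (# 3 * (x + y))
  ... | inj₁ h = ≤-gap _
    (0≤p+q (0≤p*q (0≤p*q 0≤x 0≤y) (0≤q-p h)) (0≤p*q (0≤p*q (0≤# 6) 0≤x+y) (0≤p² z)))
    (eq x y z)
    where
    eq : ∀ x y z → # 16 * (x * y) * z
         + (x * y * (# 3 * (x + y) - # 16 * z) + # 6 * (x + y) * (z * z))
       ≡ # 3 * (x + y) * (x * y + # 2 * (z * z))
    eq = solve-∀ ring
  ... | inj₂ h = ≤-gap _
    (0≤p*q (nonNegative⁻¹ ¼) (0≤p+q (0≤p*q (0≤p² (x - y)) (0≤q-p h))
      (0≤p*q 0≤x+y (0≤p*q (nonNegative⁻¹ (+ 1 / 3))
        (0≤p+q (0≤p² (# 3 * (x + y) - # 8 * z)) (0≤p*q (0≤# 8) (0≤p² z)))))))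
    (eq x y z)
    where
    eq : ∀ x y z → # 16 * (x * y) * z
         + ¼ * ((x - y) * (x - y) * (# 16 * z - # 3 * (x + y))
             + (x + y) * (+ 1 / 3 * ((# 3 * (x + y) - # 8 * z) * (# 3 * (x + y) - # 8 * z) + # 8 * (z * z))))
       ≡ # 3 * (x + y) * (x * y + # 2 * (z * z))
    eq = solve-∀ ring

  -- With P = x y and S = `pairSquares x y z`, one has S = P (P + 2 z²) + z² (x - y)². So P times
  -- the previous inequality suffices, and x + y may be enlarged to `d`.
  16P²z≤3dS : # 16 * (x * y * (x * y)) * z ≤ # 3 * d * pairSquares x y z
  16P²z≤3dS = ≤-gap _
    (0≤p+q (0≤p*q (0≤p*q (0≤# 3) (0≤q-p x+y≤d)) 0≤S)
      (0≤p+q (0≤p*q (0≤p*q (0≤# 3) 0≤x+y) (0≤p*q (0≤p² z) (0≤p² (x - y))))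
        (0≤p*q (0≤p*q 0≤x 0≤y) (0≤q-p 16Pz≤3[x+y][P+2z²]))))
    (eq x y z d)
    where
    eq : ∀ x y z d → # 16 * (x * y * (x * y)) * z
         + (# 3 * (d - (x + y)) * (x * x * (y * y) + (x * x * (z * z) + y * y * (z * z)))
           + (# 3 * (x + y) * (z * z * ((x - y) * (x - y)))
             + x * y * (# 3 * (x + y) * (x * y + # 2 * (z * z)) - # 16 * (x * y) * z)))
       ≡ # 3 * d * (x * x * (y * y) + (x * x * (z * z) + y * y * (z * z)))
    eq = solve-∀ ring

  -- AM-GM in the form (3 M - 8 P)² ≥ 0, multiplied by z / 3, leaves the error term (64 / 3) P² z,
  -- which `16P²z≤3dS` absorbs into 4 d S.
  16MPz≤3M²z+4dS : ∀ M → # 16 * M * (x * y * z) ≤ # 3 * (M * M) * z + # 4 * d * pairSquares x y z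
  16MPz≤3M²z+4dS M = ≤-gap _
    (0≤p*q (nonNegative⁻¹ (+ 1 / 3))
      (0≤p+q (0≤p*q 0≤z (0≤p² (# 3 * M - # 8 * (x * y)))) (0≤p*q (0≤# 4) (0≤q-p 16P²z≤3dS))))
    (eq x y z M d (pairSquares x y z))
    where
    eq : ∀ x y z M d S → # 16 * M * (x * y * z)
         + + 1 / 3 * (z * ((# 3 * M - # 8 * (x * y)) * (# 3 * M - # 8 * (x * y)))
                     + # 4 * (# 3 * d * S - # 16 * (x * y * (x * y)) * z))
       ≡ # 3 * (M * M) * z + # 4 * d * S
    eq = solve-∀ ring

  -- Take s² / 4 times the preceding bound. The coefficient (3 / 4) s² of M² z is then at most s² -
  -- M, because 4 M ≤ s². This is the AM-GM estimate for an edge after clearing the denominator 4 s²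
  -- M.
  edge-bound : ∀ {s M} → # 4 * M ≤ s * s →
    # 4 * (s * s) * M * (x * y * z)
      ≤ (s * s - M) * (M * M) * z + s * s * d * pairSquares x y z
  edge-bound {s} {M} 4M≤s² = ≤-gap _
    (0≤p*q (nonNegative⁻¹ ¼)
      (0≤p+q (0≤p*q (0≤p² s) (0≤q-p (16MPz≤3M²z+4dS M)))
        (0≤p*q (0≤q-p 4M≤s²) (0≤p*q (0≤p² M) 0≤z))))
    (eq (x * y * z) z s M d (pairSquares x y z))
    where
    eq : ∀ p z s M d S → # 4 * (s * s) * M * p
         + ¼ * (s * s * (# 3 * (M * M) * z + # 4 * d * S - # 16 * M * p)
               + (s * s - # 4 * M) * (M * M * z))
       ≡ (s * s - M) * (M * M) * z + s * s * d * S
    eq = solve-∀ ring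

module _ {a s M : ℚ} (0≤s : 0ℚ ≤ s) where

  -- Uses 4 b (s - a - b) ≤ (s - a)² and a (s - a) ≤ s² / 4 ≤ M.
  concentrated-bound : ∀ {b q} → 0ℚ ≤ a → a ≤ s → M ≤ a * s → s * s ≤ # 4 * M →
    q ≤ a * b * (s - (a + b)) → # 4 * s * q ≤ M * (s * s - M)
  concentrated-bound {b} {q} 0≤a a≤s M≤as s²≤4M q≤ = ≤-gap _
    (0≤p+q (0≤p*q 0≤M (0≤q-p M≤as))
    (0≤p+q (0≤p*q (0≤p*q (nonNegative⁻¹ ¼) (0≤p+q (0≤q-p s²≤4M) (0≤p² (s - # 2 * a))))
                  (0≤p*q (0≤q-p a≤s) 0≤s))
    (0≤p+q (0≤p*q (0≤p*q 0≤a 0≤s) (0≤p² (s - a - # 2 * b)))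
           (0≤p*q (0≤p*q (0≤# 4) 0≤s) (0≤q-p q≤)))))
    (eq a b s M q)
    where
    0≤M : 0ℚ ≤ M
    0≤M = *-cancelˡ-≤ {# 4} (positive⁻¹ (# 4)) (≤-trans (0≤p² s) s²≤4M)
    eq : ∀ a b s M q → # 4 * s * q
         + (M * (a * s - M)
           + (¼ * (# 4 * M - s * s + (s - # 2 * a) * (s - # 2 * a)) * ((s - a) * s)
           + (a * s * ((s - a - # 2 * b) * (s - a - # 2 * b))
           + # 4 * s * (a * b * (s - (a + b)) - q))))
       ≡ M * (s * s - M)
    eq = solve-∀ ring

-- Inserting T ≤ s - d costs -(s² - M) M² d, while E ≤ M² - C together with s² C ≥ M³ contributes at
-- most + (s² - M) M² d. The two cancel, and a factor s M is divided out.
spread-bound : ∀ {s M d q T E C} → 0ℚ < s → 0ℚ < M → 0ℚ ≤ d → M ≤ s * s →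
  M * M * M ≤ s * s * C → T ≤ s - d → E ≤ M * M - C →
  # 4 * (s * s) * M * q ≤ (s * s - M) * (M * M) * T + s * s * d * E →
  # 4 * s * q ≤ M * (s * s - M)
spread-bound {s} {M} {d} {q} {T} {E} {C} 0<s 0<M 0≤d M≤s² M³≤s²C T≤ E≤ h =
  *-cancelˡ-≤ (0<p*q 0<s 0<M) (≤-gap _
    (0≤p+q (0≤q-p h)
    (0≤p+q (0≤p*q (0≤p*q (0≤q-p M≤s²) (0≤p² M)) (0≤q-p T≤))
    (0≤p+q (0≤p*q (0≤p*q (0≤p² s) 0≤d) (0≤q-p E≤))
           (0≤p*q 0≤d (0≤q-p M³≤s²C)))))
    (eq s M d q T E C))
  where
  eq : ∀ s M d q T E C → s * M * (# 4 * s * q)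
       + (((s * s - M) * (M * M) * T + s * s * d * E - # 4 * (s * s) * M * q)
         + ((s * s - M) * (M * M) * (s - d - T)
         + (s * s * d * (M * M - C - E) + d * (s * s * C - M * M * M))))
     ≡ s * M * (M * (s * s - M))
  eq = solve-∀ ring

-- For A = s² - M, s times the left side is at most
-- (3/2) A (s (2a + s) - A) ≤ (3/8) s² (2a + s)², and s (2 - s)² ≤ 32/27 on [0, 1].
cone-bound : ∀ {a s M q} → 0ℚ ≤ a → 0ℚ < s → a + s ≡ 1ℚ →
  # 4 * s * q ≤ M * (s * s - M) → # 3 * a * (s * s - M) + # 6 * q ≤ + 4 / 9
cone-bound {a} {s} {M} {q} 0≤a 0<s a+s≡1 h = *-cancelˡ-≤ 0<s (≤-gap _
    (0≤p+q (0≤p*q (nonNegative⁻¹ (+ 3 / 2)) (0≤q-p h))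
    (0≤p+q (0≤p*q (nonNegative⁻¹ (+ 3 / 8)) (0≤p² (# 2 * (s * s - M) - s * (# 2 * a + s))))
           (0≤p*q (0≤p*q (nonNegative⁻¹ (+ 3 / 8)) (<⇒≤ 0<s))
             -- As a + s = 1, the last factor is 8/3 - s, and (s - 2/3)² (8/3 - s) = 32/27 - s (2 -
             -- s)².
             (0≤p*q (0≤p² (s - + 2 / 3))
               (0≤p+q (0≤p*q (nonNegative⁻¹ (+ 8 / 3)) 0≤a) (0≤p*q (nonNegative⁻¹ (+ 5 / 3)) (<⇒≤ 0<s)))))))
    (trans (cong (λ a → F a s M q) a≡) (eq s M q)))
  where
  F : ℚ → ℚ → ℚ → ℚ → ℚ
  F a s M q = s * (# 3 * a * (s * s - M) + # 6 * q)
    + (+ 3 / 2 * (M * (s * s - M) - # 4 * s * q)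
    + (+ 3 / 8 * ((# 2 * (s * s - M) - s * (# 2 * a + s)) * (# 2 * (s * s - M) - s * (# 2 * a + s)))
    + + 3 / 8 * s * ((s - + 2 / 3) * (s - + 2 / 3) * (+ 8 / 3 * a + + 5 / 3 * s))))
  a≡ : a ≡ 1ℚ - s
  a≡ = trans (eq₁ a s) (cong (_- s) a+s≡1)
    where
    eq₁ : ∀ a s → a ≡ a + s - s
    eq₁ = solve-∀ ring
  eq : ∀ s M q → s * (# 3 * (1ℚ - s) * (s * s - M) + # 6 * q)
    + (+ 3 / 2 * (M * (s * s - M) - # 4 * s * q)
    + (+ 3 / 8 * ((# 2 * (s * s - M) - s * (# 2 * (1ℚ - s) + s)) * (# 2 * (s * s - M) - s * (# 2 * (1ℚ - s) + s)))
    + + 3 / 8 * s * ((s - + 2 / 3) * (s - + 2 / 3) * (+ 8 / 3 * (1ℚ - s) + + 5 / 3 * s))))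
    ≡ s * (+ 4 / 9)
  eq = solve-∀ ring

-- The tangent bound for y³ at y = M / s, multiplied by s³ y.
power-tangent : ∀ {s M y} → 0ℚ ≤ s → 0ℚ ≤ M → 0ℚ ≤ y →
  # 3 * (M * M) * s * (y * y) - # 2 * (M * M * M) * y ≤ s * s * s * (y * y * (y * y))
power-tangent {s} {M} {y} 0≤s 0≤M 0≤y = ≤-gap _
  (0≤p*q 0≤y (0≤p*q (0≤p² (s * y - M)) (0≤p+q (0≤p*q 0≤s 0≤y) (0≤p*q (0≤# 2) 0≤M))))
  (eq s M y)
  where
  eq : ∀ s M y → # 3 * (M * M) * s * (y * y) - # 2 * (M * M * M) * y
       + y * ((s * y - M) * (s * y - M) * (s * y + # 2 * M))
     ≡ s * s * s * (y * y * (y * y))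
  eq = solve-∀ ring

-- Finite sums over lists.

private variable
  A B : Set

+-congˡ : ∀ r {p q} → p ≡ q → r + p ≡ r + q
+-congˡ r = cong (λ p → r + p)

∑ : List A → (A → ℚ) → ℚ
∑ xs f = sumℚ (map f xs)

infixr 5 ∑
syntax ∑ xs (λ x → e) = ∑[ x ∈ xs ] e

∑-cong : ∀ {f g : A → ℚ} xs → (∀ x → f x ≡ g x) → ∑ xs f ≡ ∑ xs g
∑-cong []       f≡g = refl
∑-cong (x ∷ xs) f≡g = cong₂ _+_ (f≡g x) (∑-cong xs f≡g)

∑-mono : ∀ {f g : A → ℚ} {xs} → All (λ x → f x ≤ g x) xs → ∑ xs f ≤ ∑ xs g
∑-mono []         = ≤-refl
∑-mono (fx ∷ fxs) = +-mono-≤ fx (∑-mono fxs)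

∑-zero : ∀ (xs : List A) → ∑[ x ∈ xs ] 0ℚ ≡ 0ℚ
∑-zero []       = refl
∑-zero (x ∷ xs) = trans (+-identityˡ _) (∑-zero xs)

0≤∑ : ∀ {f : A → ℚ} xs → (∀ x → 0ℚ ≤ f x) → 0ℚ ≤ ∑ xs f
0≤∑ xs 0≤f = subst (_≤ ∑ xs _) (∑-zero xs) (∑-mono (All.universal 0≤f xs))

∑-+ : ∀ (f g : A → ℚ) xs → ∑[ x ∈ xs ] (f x + g x) ≡ ∑ xs f + ∑ xs g
∑-+ f g []       = refl
∑-+ f g (x ∷ xs) = trans (+-congˡ (f x + g x) (∑-+ f g xs)) (interchange (f x) (g x) (∑ xs f) (∑ xs g))
  where
  interchange : ∀ a b c d → a + b + (c + d) ≡ a + c + (b + d)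
  interchange = solve-∀ ring

∑-* : ∀ c (f : A → ℚ) xs → ∑[ x ∈ xs ] (c * f x) ≡ c * ∑ xs f
∑-* c f []       = sym (*-zeroʳ c)
∑-* c f (x ∷ xs) = trans (+-congˡ (c * f x) (∑-* c f xs)) (sym (*-distribˡ-+ c (f x) (∑ xs f)))

∑-lin : ∀ c d (f g : A → ℚ) xs → ∑[ x ∈ xs ] (c * f x + d * g x) ≡ c * ∑ xs f + d * ∑ xs g
∑-lin c d f g xs = trans (∑-+ _ _ xs) (cong₂ _+_ (∑-* c f xs) (∑-* d g xs))

∑-comm : ∀ (f : A → B → ℚ) xs ys → ∑[ x ∈ xs ] ∑[ y ∈ ys ] f x y ≡ ∑[ y ∈ ys ] ∑[ x ∈ xs ] f x y
∑-comm f []       ys = sym (∑-zero ys)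
∑-comm f (x ∷ xs) ys = trans (+-congˡ (∑ ys (f x)) (∑-comm f xs ys))
  (sym (∑-+ (f x) (λ y → ∑[ x ∈ xs ] f x y) ys))

∑*∑ : ∀ (f : A → ℚ) (g : B → ℚ) xs ys → ∑ xs f * ∑ ys g ≡ ∑[ x ∈ xs ] ∑[ y ∈ ys ] (f x * g y)
∑*∑ f g xs ys = begin
  ∑ xs f * ∑ ys g                  ≡⟨ *-comm (∑ xs f) _ ⟩
  ∑ ys g * ∑ xs f                  ≡⟨ ∑-* (∑ ys g) f xs ⟨
  ∑[ x ∈ xs ] (∑ ys g * f x)       ≡⟨ ∑-cong xs (λ x → trans (*-comm (∑ ys g) (f x)) (sym (∑-* (f x) g ys))) ⟩
  ∑[ x ∈ xs ] ∑[ y ∈ ys ] (f x * g y) ∎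
  where open ≡-Reasoning

∑-++ : ∀ (f : A → ℚ) xs ys → ∑ (xs ++ ys) f ≡ ∑ xs f + ∑ ys f
∑-++ f []       ys = sym (+-identityˡ _)
∑-++ f (x ∷ xs) ys = trans (+-congˡ (f x) (∑-++ f xs ys)) (sym (+-assoc (f x) (∑ xs f) (∑ ys f)))

∑-map : ∀ (f : B → ℚ) (g : A → B) xs → ∑ (map g xs) f ≡ ∑ xs (f ∘ g)
∑-map f g xs = cong sumℚ (sym (map-∘ xs))

∑-concatMap : ∀ (f : B → ℚ) (g : A → List B) xs → ∑ (concatMap g xs) f ≡ ∑[ x ∈ xs ] ∑ (g x) f
∑-concatMap f g []       = refl
∑-concatMap f g (x ∷ xs) = trans (∑-++ f (g x) _) (+-congˡ (∑ (g x) f) (∑-concatMap f g xs))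

∑-allFin-suc : ∀ {n} (f : Fin (suc n) → ℚ) → ∑ (allFin (suc n)) f ≡ f zero + ∑ (allFin n) (f ∘ suc)
∑-allFin-suc f = cong (λ xs → f zero + sumℚ xs)
  (trans (map-tabulate suc f) (sym (map-tabulate id (f ∘ suc))))

term≤∑ : ∀ {n} (f : Fin n → ℚ) → (∀ i → 0ℚ ≤ f i) → ∀ i → f i ≤ ∑ (allFin n) f
term≤∑ {suc n} f 0≤f zero    = ≤-gap _ (0≤∑ (allFin n) (0≤f ∘ suc)) (sym (∑-allFin-suc f))
term≤∑ {suc n} f 0≤f (suc i) = ≤-trans (term≤∑ (f ∘ suc) (0≤f ∘ suc) i)
  (≤-gap _ (0≤f zero) (trans (+-comm _ (f zero)) (sym (∑-allFin-suc f))))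

-- Indicators, and cardinalities as sums of indicators.

⟦_⟧ : Bool → ℚ
⟦ true  ⟧ = 1ℚ
⟦ false ⟧ = 0ℚ

0≤⟦_⟧ : ∀ b → 0ℚ ≤ ⟦ b ⟧
0≤⟦ true  ⟧ = nonNegative⁻¹ 1ℚ
0≤⟦ false ⟧ = ≤-refl

⟦∧⟧ : ∀ a b → ⟦ a ∧ b ⟧ ≡ ⟦ a ⟧ * ⟦ b ⟧
⟦∧⟧ true  b = sym (*-identityˡ ⟦ b ⟧)
⟦∧⟧ false b = sym (*-zeroˡ ⟦ b ⟧)

δ : ∀ {n} → Fin n → Fin n → ℚ
δ i j = ⟦ ⌊ i ≟ᶠ j ⌋ ⟧

∑-δ : ∀ {n} i (f : Fin n → ℚ) → ∑[ j ∈ allFin n ] (δ i j * f j) ≡ f i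
∑-δ {suc n} zero f = begin
  ∑[ j ∈ allFin (suc n) ] (δ zero j * f j)        ≡⟨ ∑-allFin-suc (λ j → δ zero j * f j) ⟩
  1ℚ * f zero + (∑[ j ∈ allFin n ] (0ℚ * f (suc j))) ≡⟨ cong₂ _+_ (*-identityˡ (f zero))
                                                      (trans (∑-* 0ℚ (f ∘ suc) (allFin n)) (*-zeroˡ (∑ (allFin n) (f ∘ suc)))) ⟩
  f zero + 0ℚ                                     ≡⟨ +-identityʳ _ ⟩
  f zero                                          ∎
  where open ≡-Reasoning
∑-δ {suc n} (suc i) f = begin
  ∑[ j ∈ allFin (suc n) ] (δ (suc i) j * f j)     ≡⟨ ∑-allFin-suc (λ j → δ (suc i) j * f j) ⟩
  0ℚ * f zero + (∑[ j ∈ allFin n ] (δ (suc i) (suc j) * f (suc j)))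
    ≡⟨ cong₂ _+_ (*-zeroˡ (f zero)) (∑-cong (allFin n) (λ j → cong (_* f (suc j)) (δ-suc j))) ⟩
  0ℚ + (∑[ j ∈ allFin n ] (δ i j * f (suc j)))      ≡⟨ +-identityˡ _ ⟩
  ∑[ j ∈ allFin n ] (δ i j * f (suc j))           ≡⟨ ∑-δ i (f ∘ suc) ⟩
  f (suc i)                                       ∎
  where
  open ≡-Reasoning
  δ-suc : ∀ j → δ (suc i) (suc j) ≡ δ i j
  δ-suc j with i ≟ᶠ j
  ... | yes _ = refl
  ... | no _  = refl

#-suc : ∀ k → # (suc k) ≡ 1ℚ + # k
#-suc k = begin
  -- On the literal `mkℚ (+ k) 0` the sum unfolds to a fraction with numerator 1 + k * 1. The round
  -- trip through unnormalised rationals identifies that literal with `# k`.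
  # (suc k)               ≡⟨ cong (λ m → (ℤ.1ℤ ℤ.+ m) / 1) (sym (ℤ.*-identityʳ (+ k))) ⟩
  1ℚ + mkℚ (+ k) 0 (c k)  ≡⟨ +-congˡ 1ℚ (sym (fromℚᵘ-toℚᵘ (mkℚ (+ k) 0 (c k)))) ⟩
  1ℚ + # k                ∎
  where
  open ≡-Reasoning
  c : ∀ k → Coprime k 1
  c k = Coprime.sym (1-coprimeTo k)

#-mono : ∀ {j k} → j ℕ.≤ k → # j ≤ # k
#-mono {k = k} ℕ.z≤n = 0≤# k
#-mono {suc j} {suc k} (ℕ.s≤s j≤k) =
  subst₂ _≤_ (sym (#-suc j)) (sym (#-suc k)) (+-monoʳ-≤ 1ℚ (#-mono j≤k))

#-length-filter : ∀ (p : A → Bool) xs → # (length (filterᵇ p xs)) ≡ ∑[ x ∈ xs ] ⟦ p x ⟧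
#-length-filter p []       = refl
#-length-filter p (x ∷ xs) with p x
... | true  = trans (#-suc (length (filterᵇ p xs))) (+-congˡ 1ℚ (#-length-filter p xs))
... | false = trans (#-length-filter p xs) (sym (+-identityˡ _))

#-∣∣ : ∀ {n} (S : Subset n) → # ∣ S ∣ ≡ ∑[ i ∈ allFin n ] ⟦ lookup S i ⟧
#-∣∣ []          = refl
#-∣∣ (true  ∷ S) = trans (#-suc ∣ S ∣) (trans (+-congˡ 1ℚ (#-∣∣ S)) (sym (∑-allFin-suc λ i → ⟦ lookup (true ∷ S) i ⟧)))
#-∣∣ (false ∷ S) = trans (#-∣∣ S) (trans (sym (+-identityˡ _)) (sym (∑-allFin-suc λ i → ⟦ lookup (false ∷ S) i ⟧)))

2≤∣S∣ : ∀ {n} {S : Subset n} {u v} → u ≢ v → u ∈ S → v ∈ S → 2 ℕ.≤ ∣ S ∣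
2≤∣S∣ u≢v u∈S v∈S = ℕ.≤-trans (ℕ.s≤s (ℕ.≤-trans (ℕ.s≤s ℕ.z≤n) (x∈p⇒∣p-x∣<∣p∣ (x∈p∧x≢y⇒x∈p-y u∈S u≢v))))
  (x∈p⇒∣p-x∣<∣p∣ v∈S)

-- Sparsity summed over the level sets of the weights.

minimum : ∀ {n} → (Fin n → ℚ) → Triple n → ℚ
minimum y (i , j , k) = y i ⊓ (y j ⊓ y k)

-- The minimum is one of the three weights, so an estimate proved for each choice of a distinguished
-- vertex holds for the smallest one without deciding which it is.
minimum-elim : ∀ {n} (y : Fin n → ℚ) (P : ℚ → Set) ((i , j , k) : Triple n) →
  P (y i) → P (y j) → P (y k) → P (minimum y (i , j , k))
minimum-elim y P (i , j , k) Pi Pj Pk = ⊓-elim (y i) _ Pi (⊓-elim (y j) (y k) Pj Pk)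
  where
  ⊓-elim : ∀ p q → P p → P q → P (p ⊓ q)
  ⊓-elim p q Pp Pq with ⊓-sel p q
  ... | inj₁ e = subst P (sym e) Pp
  ... | inj₂ e = subst P (sym e) Pq

-- The positive part of p - t, that is, the integral of the indicator of τ ≤ p over thresholds τ
-- above t. Sums of excesses are therefore integrals of level-set counts.
excess : ℚ → ℚ → ℚ
excess t p = (p - t) ⊔ 0ℚ

0≤excess : ∀ t p → 0ℚ ≤ excess t p
0≤excess t p = p≤q⊔p (p - t) 0ℚ

excess-≤ : ∀ {t p} → p ≤ t → excess t p ≡ 0ℚ
excess-≤ {t} {p} p≤t = p≤q⇒p⊔q≡q (subst (p - t ≤_) (+-inverseʳ t) (+-monoˡ-≤ (- t) p≤t))

excess-≥ : ∀ {t p} → t ≤ p → excess t p ≡ p - t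
excess-≥ t≤p = p≥q⇒p⊔q≡p (0≤q-p t≤p)

-- A discrete integration step: since `p` is not strictly between `t` and `τ`, its indicator is
-- constant over that interval.
excess-step : ∀ {t τ p} → t ≤ τ → p ≤ t ⊎ τ ≤ p →
  excess t p ≡ excess τ p + (τ - t) * ⟦ ⌊ τ ≤? p ⌋ ⟧
excess-step {t} {τ} {p} t≤τ h with τ ≤? p | h
... | yes τ≤p | _ = trans (excess-≥ (≤-trans t≤τ τ≤p)) (trans (eq p t τ) (cong (_+ (τ - t) * 1ℚ) (sym (excess-≥ τ≤p))))
  where
  eq : ∀ p t τ → p - t ≡ p - τ + (τ - t) * 1ℚ
  eq = solve-∀ ring
... | no  τ≰p | inj₁ p≤t = trans (excess-≤ p≤t) (trans (eq t τ) (cong (_+ (τ - t) * 0ℚ) (sym (excess-≤ (≤-trans p≤t t≤τ)))))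
  where
  eq : ∀ t τ → 0ℚ ≡ 0ℚ + (τ - t) * 0ℚ
  eq = solve-∀ ring
... | no  τ≰p | inj₂ τ≤p = ⊥-elim (τ≰p τ≤p)

module _ {n} (Q : List (Triple n)) (sparse : Sparse Q) {u v : Fin n} (u≢v : u ≢ v) where

  -- Forcing `u` and `v` into the set guarantees two elements, so sparsity applies and the truncated
  -- `∸ 2` becomes a genuine subtraction.
  induced-bound : ∀ (b : Fin n → Bool) → b u ≡ true → b v ≡ true →
    ∑[ e ∈ Q ] ⟦ inSubset (Vec.tabulate b) e ⟧ ≤ (∑[ i ∈ allFin n ] ⟦ b i ⟧) - # 2
  induced-bound b bu bv = begin
    ∑[ e ∈ Q ] ⟦ inSubset S e ⟧              ≡⟨ #-length-filter (inSubset S) Q ⟨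
    # (inducedCount Q S)                     ≤⟨ #-mono (sparse S 2≤S) ⟩
    # (∣ S ∣ ℕ.∸ 2)                          ≡⟨ #-∸2 2≤S ⟩
    # ∣ S ∣ - # 2                            ≡⟨ cong (λ r → r - # 2) (trans (#-∣∣ S)
                                                  (∑-cong (allFin n) (cong ⟦_⟧ ∘ lookup∘tabulate b))) ⟩
    (∑[ i ∈ allFin n ] ⟦ b i ⟧) - # 2        ∎
    where
    open ≤-Reasoning
    S = Vec.tabulate b
    member : ∀ i → b i ≡ true → i ∈ S
    member i bi = lookup⇒[]= i S (trans (lookup∘tabulate b i) bi)
    2≤S : 2 ℕ.≤ ∣ S ∣
    2≤S = 2≤∣S∣ u≢v (member u bu) (member v bv)
    #-∸2 : ∀ {m} → 2 ℕ.≤ m → # (m ℕ.∸ 2) ≡ # m - # 2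
    #-∸2 {suc (suc m)} _ = trans (eq (# m)) (cong (λ r → r - # 2) (sym (trans (#-suc (suc m)) (+-congˡ 1ℚ (#-suc m)))))
      where
      eq : ∀ p → p ≡ 1ℚ + (1ℚ + p) - # 2
      eq = solve-∀ ring
    #-∸2 {suc zero} (ℕ.s≤s ())

  private
    -- The indicator of the vertices other than `u` and `v`. Over a set containing both, its sum is
    -- the cardinality minus two, the quantity in the sparsity condition.
    c : Fin n → ℚ
    c i = 1ℚ - (δ u i + δ v i)

    0≤c : ∀ i → 0ℚ ≤ c i
    0≤c i with u ≟ᶠ i | v ≟ᶠ i
    ... | yes refl | yes refl = ⊥-elim (u≢v refl)
    ... | yes _    | no _     = ≤-refl
    ... | no _     | yes _    = ≤-refl
    ... | no _     | no _     = nonNegative⁻¹ 1ℚ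

    ∑-c : ∀ f → ∑[ i ∈ allFin n ] (c i * f i) ≡ ∑ (allFin n) f - (f u + f v)
    ∑-c f = begin
      ∑[ i ∈ allFin n ] (c i * f i)
        ≡⟨ ∑-cong (allFin n) (λ i → eq₁ (δ u i) (δ v i) (f i)) ⟩
      ∑[ i ∈ allFin n ] (1ℚ * f i + - 1ℚ * (δ u i * f i + δ v i * f i))
        ≡⟨ ∑-lin 1ℚ (- 1ℚ) f (λ i → δ u i * f i + δ v i * f i) (allFin n) ⟩
      1ℚ * ∑ (allFin n) f + - 1ℚ * (∑[ i ∈ allFin n ] (δ u i * f i + δ v i * f i))
        ≡⟨ cong (λ r → 1ℚ * ∑ (allFin n) f + - 1ℚ * r)
             (trans (∑-+ (λ i → δ u i * f i) (λ i → δ v i * f i) (allFin n)) (cong₂ _+_ (∑-δ u f) (∑-δ v f))) ⟩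
      1ℚ * ∑ (allFin n) f + - 1ℚ * (f u + f v)
        ≡⟨ eq₂ (∑ (allFin n) f) (f u) (f v) ⟩
      ∑ (allFin n) f - (f u + f v) ∎
      where
      open ≡-Reasoning
      eq₁ : ∀ d e p → (1ℚ - (d + e)) * p ≡ 1ℚ * p + - 1ℚ * (d * p + e * p)
      eq₁ = solve-∀ ring
      eq₂ : ∀ p q r → 1ℚ * p + - 1ℚ * (q + r) ≡ p - (q + r)
      eq₂ = solve-∀ ring

  module _ (y : Fin n → ℚ) where

    private
      -- The level set at `τ`, enlarged by `u` and `v` so that sparsity is available at every
      -- threshold. The enlargement is free because `c` vanishes at both vertices.
      outer : ℚ → Fin n → Bool
      outer τ i = ⌊ τ ≤? y i ⌋ ∨ (⌊ u ≟ᶠ i ⌋ ∨ ⌊ v ≟ᶠ i ⌋)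

      outer-≤ : ∀ τ i → τ ≤ y i → outer τ i ≡ true
      outer-≤ τ i τ≤yi with τ ≤? y i
      ... | yes _    = refl
      ... | no τ≰yi  = ⊥-elim (τ≰yi τ≤yi)

      outer-u : ∀ τ → outer τ u ≡ true
      outer-u τ with u ≟ᶠ u
      ... | yes _  = ∨-zeroʳ _
      ... | no u≢u = ⊥-elim (u≢u refl)

      outer-v : ∀ τ → outer τ v ≡ true
      outer-v τ with v ≟ᶠ v
      ... | yes _  = trans (cong (⌊ τ ≤? y v ⌋ ∨_) (∨-zeroʳ _)) (∨-zeroʳ _)
      ... | no v≢v = ⊥-elim (v≢v refl)

      annihilate : ∀ p q r s → 0ℚ * p ≡ 0ℚ * q + r * (0ℚ * s)
      annihilate = solve-∀ ring

      vertex-step : ∀ {t τ} i → t ≤ τ → y i ≤ t ⊎ τ ≤ y i →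
        c i * excess t (y i) ≡ c i * excess τ (y i) + (τ - t) * (c i * ⟦ outer τ i ⟧)
      vertex-step {t} {τ} i t≤τ h with u ≟ᶠ i | v ≟ᶠ i
      ... | yes refl | yes refl = ⊥-elim (u≢v refl)
      ... | yes _ | no _  = annihilate (excess t (y i)) (excess τ (y i)) (τ - t) ⟦ ⌊ τ ≤? y i ⌋ ∨ true ⟧
      ... | no _  | yes _ = annihilate (excess t (y i)) (excess τ (y i)) (τ - t) ⟦ ⌊ τ ≤? y i ⌋ ∨ true ⟧
      ... | no _  | no _  = begin
        1ℚ * excess t (y i)
          ≡⟨ cong (1ℚ *_) (excess-step t≤τ h) ⟩
        1ℚ * (excess τ (y i) + (τ - t) * ⟦ ⌊ τ ≤? y i ⌋ ⟧)
          ≡⟨ distribute (excess τ (y i)) (τ - t) ⟦ ⌊ τ ≤? y i ⌋ ⟧ ⟩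
        1ℚ * excess τ (y i) + (τ - t) * (1ℚ * ⟦ ⌊ τ ≤? y i ⌋ ⟧)
          ≡⟨ cong (λ b → 1ℚ * excess τ (y i) + (τ - t) * (1ℚ * ⟦ b ⟧)) (∨-identityʳ ⌊ τ ≤? y i ⌋) ⟨
        1ℚ * excess τ (y i) + (τ - t) * (1ℚ * ⟦ ⌊ τ ≤? y i ⌋ ∨ false ⟧) ∎
        where
        open ≡-Reasoning
        distribute : ∀ q r s → 1ℚ * (q + r * s) ≡ 1ℚ * q + r * (1ℚ * s)
        distribute = solve-∀ ring

      -- An edge whose minimum reaches `τ` lies inside the level set. Other edges may lie inside the
      -- enlarged set as well, hence only an inequality.
      edge-step : ∀ {t τ} → t ≤ τ → (∀ i → y i ≤ t ⊎ τ ≤ y i) → ∀ e →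
        excess t (minimum y e) ≤ excess τ (minimum y e) + (τ - t) * ⟦ inSubset (Vec.tabulate (outer τ)) e ⟧
      edge-step {t} {τ} t≤τ h e@(i , j , k) = ≤-trans
        (≤-reflexive (excess-step t≤τ (minimum-elim y (λ p → p ≤ t ⊎ τ ≤ p) e (h i) (h j) (h k))))
        (+-monoʳ-≤ (excess τ (minimum y e)) (*-monoˡ-≤ (0≤q-p t≤τ) inside))
        where
        S = Vec.tabulate (outer τ)
        member : ∀ l → minimum y e ≤ y l → τ ≤ minimum y e → lookup S l ≡ true
        member l m≤ τ≤m = trans (lookup∘tabulate (outer τ) l) (outer-≤ τ l (≤-trans τ≤m m≤))
        inside : ⟦ ⌊ τ ≤? minimum y e ⌋ ⟧ ≤ ⟦ inSubset S e ⟧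
        inside with τ ≤? minimum y e
        ... | no _ = 0≤⟦ inSubset S e ⟧
        ... | yes τ≤m rewrite member i (p⊓q≤p (y i) _) τ≤m
                            | member j (≤-trans (p⊓q≤q (y i) _) (p⊓q≤p (y j) (y k))) τ≤m
                            | member k (≤-trans (p⊓q≤q (y i) _) (p⊓q≤q (y j) (y k))) τ≤m = ≤-refl

    -- As the threshold t decreases, the left side grows at rate at most |Q[S]|
    -- and the right side at rate |S| - 2, where S consists of u, v and the
    -- vertices of value above t; ts lists the values of y above t.
    excess-bound : ∀ {ts} t → AllPairs _≤_ ts → (∀ i → y i ≤ t ⊎ y i List.∈ ts) →
      ∑[ e ∈ Q ] excess t (minimum y e) ≤ ∑[ i ∈ allFin n ] (c i * excess t (y i))
    excess-bound {[]} t [] h = begin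
      ∑[ e ∈ Q ] excess t (minimum y e)            ≤⟨ ∑-mono (All.universal (λ e → ≤-reflexive (excess-≤ (low e))) Q) ⟩
      ∑[ e ∈ Q ] 0ℚ                                ≡⟨ ∑-zero Q ⟩
      0ℚ                                           ≤⟨ 0≤∑ (allFin n) (λ i → 0≤p*q (0≤c i) (0≤excess t (y i))) ⟩
      ∑[ i ∈ allFin n ] (c i * excess t (y i))     ∎
      where
      open ≤-Reasoning
      below : ∀ i → y i ≤ t
      below i with h i
      ... | inj₁ yi≤t = yi≤t
      ... | inj₂ ()
      low : ∀ e → minimum y e ≤ t
      low (i , j , k) = ≤-trans (p⊓q≤p (y i) _) (below i)
    excess-bound {τ ∷ ts} t (τ≤ts ∷ sorted-ts) h with ≤-total τ t
    -- A head not exceeding `t`, such as a repeated value, opens no interval and is discarded.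
    ... | inj₁ τ≤t = excess-bound t sorted-ts h′
      where
      h′ : ∀ i → y i ≤ t ⊎ y i List.∈ ts
      h′ i with h i
      ... | inj₁ yi≤t         = inj₁ yi≤t
      ... | inj₂ (here yi≡τ)  = inj₁ (≤-trans (≤-reflexive yi≡τ) τ≤t)
      ... | inj₂ (there yi∈)  = inj₂ yi∈
    ... | inj₂ t≤τ = begin
      ∑[ e ∈ Q ] excess t (minimum y e)
        ≤⟨ ∑-mono (All.universal (edge-step t≤τ gap) Q) ⟩
      ∑[ e ∈ Q ] (excess τ (minimum y e) + (τ - t) * ⟦ inS e ⟧)
        ≡⟨ trans (∑-+ (λ e → excess τ (minimum y e)) _ Q) (+-congˡ E (∑-* (τ - t) (⟦_⟧ ∘ inS) Q)) ⟩
      E + (τ - t) * (∑[ e ∈ Q ] ⟦ inS e ⟧)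
        ≤⟨ +-mono-≤ (excess-bound τ sorted-ts h′) (*-monoˡ-≤ (0≤q-p t≤τ) (induced-bound (outer τ) (outer-u τ) (outer-v τ))) ⟩
      V + (τ - t) * ((∑[ i ∈ allFin n ] ⟦ outer τ i ⟧) - # 2)
        ≡⟨ cong (λ r → V + (τ - t) * r) (sym (trans (∑-c (⟦_⟧ ∘ outer τ))
             (cong (λ r → (∑[ i ∈ allFin n ] ⟦ outer τ i ⟧) - r) (cong₂ (λ a b → ⟦ a ⟧ + ⟦ b ⟧) (outer-u τ) (outer-v τ))))) ⟩
      V + (τ - t) * (∑[ i ∈ allFin n ] (c i * ⟦ outer τ i ⟧))
        ≡⟨ trans (∑-+ (λ i → c i * excess τ (y i)) _ (allFin n)) (+-congˡ V (∑-* (τ - t) (λ i → c i * ⟦ outer τ i ⟧) (allFin n))) ⟨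
      ∑[ i ∈ allFin n ] (c i * excess τ (y i) + (τ - t) * (c i * ⟦ outer τ i ⟧))
        ≡⟨ ∑-cong (allFin n) (λ i → vertex-step i t≤τ (gap i)) ⟨
      ∑[ i ∈ allFin n ] (c i * excess t (y i)) ∎
      where
      open ≤-Reasoning
      inS = inSubset (Vec.tabulate (outer τ))
      E = ∑[ e ∈ Q ] excess τ (minimum y e)
      V = ∑[ i ∈ allFin n ] (c i * excess τ (y i))
      gap : ∀ i → y i ≤ t ⊎ τ ≤ y i
      gap i with h i
      ... | inj₁ yi≤t        = inj₁ yi≤t
      ... | inj₂ (here yi≡τ) = inj₂ (≤-reflexive (sym yi≡τ))
      ... | inj₂ (there yi∈) = inj₂ (All.lookup τ≤ts yi∈)
      h′ : ∀ i → y i ≤ τ ⊎ y i List.∈ ts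
      h′ i with h i
      ... | inj₁ yi≤t        = inj₁ (≤-trans yi≤t t≤τ)
      ... | inj₂ (here yi≡τ) = inj₁ (≤-reflexive yi≡τ)
      ... | inj₂ (there yi∈) = inj₂ yi∈

    -- This is threshold 0, where the excess of a nonnegative weight is the weight itself; the
    -- sorted list of all weights supplies the breakpoints.
    sparse-bound : (∀ i → 0ℚ ≤ y i) → ∑[ e ∈ Q ] minimum y e ≤ ∑ (allFin n) y - (y u + y v)
    sparse-bound 0≤y = begin
      ∑[ e ∈ Q ] minimum y e                   ≤⟨ ∑-mono (All.universal (λ e → excess₀-≥ (minimum y e)) Q) ⟩
      ∑[ e ∈ Q ] excess 0ℚ (minimum y e)       ≤⟨ excess-bound 0ℚ (Linked⇒AllPairs ≤-trans (sort-↗ values)) covered ⟩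
      ∑[ i ∈ allFin n ] (c i * excess 0ℚ (y i)) ≡⟨ ∑-cong (allFin n) (λ i → cong (c i *_) (trans (excess-≥ (0≤y i)) (+-identityʳ (y i)))) ⟩
      ∑[ i ∈ allFin n ] (c i * y i)            ≡⟨ ∑-c y ⟩
      ∑ (allFin n) y - (y u + y v)             ∎
      where
      open ≤-Reasoning
      open import Data.List.Sort ≤-decTotalOrder using (sort; sort-↗; sort-↭)
      values = map y (allFin n)
      covered : ∀ i → y i ≤ 0ℚ ⊎ y i List.∈ sort values
      covered i = inj₂ (∈-resp-↭ (↭-sym (sort-↭ values)) (∈-map⁺ y (∈-allFin i)))
      excess₀-≥ : ∀ p → p ≤ excess 0ℚ p
      excess₀-≥ p = subst (_≤ excess 0ℚ p) (+-identityʳ p) (p≤p⊔q (p - 0ℚ) 0ℚ)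

-- Double counting of pairs with the codegree condition.

∑-offDiagonal : ∀ {n} (g : Fin n → Fin n → ℚ) →
  ∑[ i ∈ allFin n ] ∑[ j ∈ allFin n ] ((1ℚ - δ i j) * g i j)
    ≡ (∑[ i ∈ allFin n ] ∑[ j ∈ allFin n ] g i j) - (∑[ i ∈ allFin n ] g i i)
∑-offDiagonal {n} g = begin
  ∑[ i ∈ V ] ∑[ j ∈ V ] ((1ℚ - δ i j) * g i j)
    ≡⟨ ∑-cong V (λ i → trans (∑-cong V (λ j → split (δ i j) (g i j)))
         (trans (∑-lin 1ℚ (- 1ℚ) (g i) (λ j → δ i j * g i j) V)
                (cong (λ r → 1ℚ * ∑ V (g i) + - 1ℚ * r) (∑-δ i (g i))))) ⟩
  ∑[ i ∈ V ] (1ℚ * ∑ V (g i) + - 1ℚ * g i i)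
    ≡⟨ ∑-lin 1ℚ (- 1ℚ) (λ i → ∑ V (g i)) (λ i → g i i) V ⟩
  1ℚ * (∑[ i ∈ V ] ∑ V (g i)) + - 1ℚ * (∑[ i ∈ V ] g i i)
    ≡⟨ merge (∑[ i ∈ V ] ∑ V (g i)) (∑[ i ∈ V ] g i i) ⟩
  (∑[ i ∈ V ] ∑ V (g i)) - (∑[ i ∈ V ] g i i) ∎
  where
  open ≡-Reasoning
  V = allFin n
  split : ∀ d p → (1ℚ - d) * p ≡ 1ℚ * p + - 1ℚ * (d * p)
  split = solve-∀ ring
  merge : ∀ p q → 1ℚ * p + - 1ℚ * q ≡ p - q
  merge = solve-∀ ring

χ : ∀ {n} → Triple n → Fin n → ℚ
χ e i = ⟦ hasVertex i e ⟧

-- Sortedness makes the three vertices distinct, so at most one disjunct of `hasVertex` holds and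
-- the disjunction is a sum.
χ≡δ+δ+δ : ∀ {n} {a b c : Fin n} → Sorted (a , b , c) → ∀ i → χ (a , b , c) i ≡ δ a i + (δ b i + δ c i)
χ≡δ+δ+δ {a = a} {b} {c} (a<b , b<c) i with a ≟ᶠ i | b ≟ᶠ i | c ≟ᶠ i
... | yes refl | yes refl | _        = ⊥-elim (Fin.<⇒≢ a<b refl)
... | yes refl | _        | yes refl = ⊥-elim (Fin.<⇒≢ (Fin.<-trans a<b b<c) refl)
... | _        | yes refl | yes refl = ⊥-elim (Fin.<⇒≢ b<c refl)
... | yes _    | no _     | no _     = refl
... | no _     | yes _    | no _     = refl
... | no _     | no _     | yes _    = refl
... | no _     | no _     | no _     = refl

∑-χ : ∀ {n} {a b c : Fin n} → Sorted (a , b , c) → ∀ f →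
  ∑[ i ∈ allFin n ] (χ (a , b , c) i * f i) ≡ f a + (f b + f c)
∑-χ {n} {a} {b} {c} abc f = begin
  ∑[ i ∈ V ] (χ (a , b , c) i * f i)
    ≡⟨ ∑-cong V (λ i → trans (cong (_* f i) (χ≡δ+δ+δ abc i)) (expand (δ a i) (δ b i) (δ c i) (f i))) ⟩
  ∑[ i ∈ V ] (δ a i * f i + (δ b i * f i + δ c i * f i))
    ≡⟨ trans (∑-+ (λ i → δ a i * f i) (λ i → δ b i * f i + δ c i * f i) V)
         (+-congˡ (∑[ i ∈ V ] (δ a i * f i)) (∑-+ (λ i → δ b i * f i) (λ i → δ c i * f i) V)) ⟩
  (∑[ i ∈ V ] (δ a i * f i)) + ((∑[ i ∈ V ] (δ b i * f i)) + (∑[ i ∈ V ] (δ c i * f i)))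
    ≡⟨ cong₂ _+_ (∑-δ a f) (cong₂ _+_ (∑-δ b f) (∑-δ c f)) ⟩
  f a + (f b + f c) ∎
  where
  open ≡-Reasoning
  V = allFin n
  expand : ∀ p q r s → (p + (q + r)) * s ≡ p * s + (q * s + r * s)
  expand = solve-∀ ring

module _ {n} (y : Fin n → ℚ) where

  private
    V = allFin n
    sq : Fin n → ℚ
    sq i = y i * y i

  edgeProduct edgePairSquares : Triple n → ℚ
  edgeProduct (i , j , k) = y i * y j * y k
  edgePairSquares (i , j , k) = pairSquares (y i) (y j) (y k)

  -- Spreading the bracket of an edge over ordered pairs of vertices, each unordered pair twice,
  -- lets the sum over edges be exchanged with the sum over pairs.
  edgePairSquares-∑∑ : ∀ e → Sorted e →
    ∑[ i ∈ V ] ∑[ j ∈ V ] ((1ℚ - δ i j) * (χ e i * sq i * (χ e j * sq j))) ≡ # 2 * edgePairSquares e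
  edgePairSquares-∑∑ e@(a , b , c) sorted-e = begin
    ∑[ i ∈ V ] ∑[ j ∈ V ] ((1ℚ - δ i j) * (χ e i * sq i * (χ e j * sq j)))
      ≡⟨ ∑-offDiagonal (λ i j → χ e i * sq i * (χ e j * sq j)) ⟩
    (∑[ i ∈ V ] ∑[ j ∈ V ] (χ e i * sq i * (χ e j * sq j))) - (∑[ i ∈ V ] (χ e i * sq i * (χ e i * sq i)))
      ≡⟨ cong₂ _-_ (sym (∑*∑ (λ i → χ e i * sq i) (λ i → χ e i * sq i) V V))
                   (∑-cong V (λ i → idem (hasVertex i e) (sq i))) ⟩
    (∑[ i ∈ V ] (χ e i * sq i)) * (∑[ i ∈ V ] (χ e i * sq i)) - (∑[ i ∈ V ] (χ e i * (sq i * sq i)))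
      ≡⟨ cong₂ _-_ (cong₂ _*_ (∑-χ sorted-e sq) (∑-χ sorted-e sq)) (∑-χ sorted-e (λ i → sq i * sq i)) ⟩
    (sq a + (sq b + sq c)) * (sq a + (sq b + sq c)) - (sq a * sq a + (sq b * sq b + sq c * sq c))
      ≡⟨ eq (y a) (y b) (y c) ⟩
    # 2 * edgePairSquares e ∎
    where
    open ≡-Reasoning
    idem : ∀ b p → ⟦ b ⟧ * p * (⟦ b ⟧ * p) ≡ ⟦ b ⟧ * (p * p)
    idem true  = solve-∀ ring
    idem false = solve-∀ ring
    eq : ∀ p q r → (p * p + (q * q + r * r)) * (p * p + (q * q + r * r))
           - (p * p * (p * p) + (q * q * (q * q) + r * r * (r * r)))
         ≡ # 2 * (p * p * (q * q) + (p * p * (r * r) + q * q * (r * r)))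
    eq = solve-∀ ring

  -- After the exchange of sums, the term of an ordered pair i ≠ j is yᵢ² yⱼ² times its codegree,
  -- which is at most 2. This 2 cancels the 2 from counting ordered pairs.
  codegree-bound : ∀ {Q : List (Triple n)} → All Sorted Q → MaxCodegAtMost Q 2 →
    ∑ Q edgePairSquares ≤ ∑ V sq * ∑ V sq - (∑[ i ∈ V ] (sq i * sq i))
  codegree-bound {Q} sorted-Q codeg≤2 = *-cancelˡ-≤ {# 2} (positive⁻¹ (# 2)) (begin
    # 2 * ∑ Q edgePairSquares
      ≡⟨ ∑-* (# 2) edgePairSquares Q ⟨
    ∑[ e ∈ Q ] (# 2 * edgePairSquares e)
      ≤⟨ ∑-mono (All.map (λ {e} s → ≤-reflexive (sym (edgePairSquares-∑∑ e s))) sorted-Q) ⟩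
    ∑[ e ∈ Q ] ∑[ i ∈ V ] ∑[ j ∈ V ] ((1ℚ - δ i j) * (χ e i * sq i * (χ e j * sq j)))
      ≡⟨ ∑-comm (λ e i → ∑[ j ∈ V ] ((1ℚ - δ i j) * (χ e i * sq i * (χ e j * sq j)))) Q V ⟩
    ∑[ i ∈ V ] ∑[ e ∈ Q ] ∑[ j ∈ V ] ((1ℚ - δ i j) * (χ e i * sq i * (χ e j * sq j)))
      ≡⟨ ∑-cong V (λ i → ∑-comm (λ e j → (1ℚ - δ i j) * (χ e i * sq i * (χ e j * sq j))) Q V) ⟩
    ∑[ i ∈ V ] ∑[ j ∈ V ] ∑[ e ∈ Q ] ((1ℚ - δ i j) * (χ e i * sq i * (χ e j * sq j)))
      ≤⟨ ∑-mono (All.universal (λ i → ∑-mono (All.universal (pair-bound i) V)) V) ⟩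
    ∑[ i ∈ V ] ∑[ j ∈ V ] (# 2 * ((1ℚ - δ i j) * (sq i * sq j)))
      ≡⟨ ∑-cong V (λ i → ∑-* (# 2) (λ j → (1ℚ - δ i j) * (sq i * sq j)) V) ⟩
    ∑[ i ∈ V ] (# 2 * (∑[ j ∈ V ] ((1ℚ - δ i j) * (sq i * sq j))))
      ≡⟨ ∑-* (# 2) (λ i → ∑[ j ∈ V ] ((1ℚ - δ i j) * (sq i * sq j))) V ⟩
    # 2 * (∑[ i ∈ V ] ∑[ j ∈ V ] ((1ℚ - δ i j) * (sq i * sq j)))
      ≡⟨ cong (# 2 *_) (∑-offDiagonal (λ i j → sq i * sq j)) ⟩
    # 2 * ((∑[ i ∈ V ] ∑[ j ∈ V ] (sq i * sq j)) - (∑[ i ∈ V ] (sq i * sq i)))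
      ≡⟨ cong (λ r → # 2 * (r - (∑[ i ∈ V ] (sq i * sq i)))) (∑*∑ sq sq V V) ⟨
    # 2 * (∑ V sq * ∑ V sq - (∑[ i ∈ V ] (sq i * sq i))) ∎)
    where
    open ≤-Reasoning
    regroup : ∀ d p q r s → d * (p * q * (r * s)) ≡ d * (q * s) * (p * r)
    regroup = solve-∀ ring
    ∑χχ : ∀ i j → ∑[ e ∈ Q ] (χ e i * χ e j) ≡ # (codeg Q i j)
    ∑χχ i j = trans (∑-cong Q (λ e → sym (⟦∧⟧ (hasVertex i e) (hasVertex j e))))
      (sym (#-length-filter (λ e → hasVertex i e ∧ hasVertex j e) Q))
    weighted : ∀ i j c → (i ≢ j → c ℕ.≤ 2) →
      (1ℚ - δ i j) * (sq i * sq j) * # c ≤ # 2 * ((1ℚ - δ i j) * (sq i * sq j))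
    weighted i j c c≤2 with i ≟ᶠ j
    -- The codegree condition says nothing on the diagonal, where the factor 1 - δ vanishes.
    ... | yes _   = ≤-reflexive (zeros (sq i * sq j) (# c))
      where
      zeros : ∀ p q → 0ℚ * p * q ≡ # 2 * (0ℚ * p)
      zeros = solve-∀ ring
    ... | no i≢j = ≤-trans (*-monoˡ-≤ (0≤p*q (nonNegative⁻¹ 1ℚ) (0≤p*q (0≤p² (y i)) (0≤p² (y j)))) (#-mono (c≤2 i≢j)))
        (≤-reflexive (*-comm (1ℚ * (sq i * sq j)) (# 2)))
    pair-bound : ∀ i j → ∑[ e ∈ Q ] ((1ℚ - δ i j) * (χ e i * sq i * (χ e j * sq j))) ≤ # 2 * ((1ℚ - δ i j) * (sq i * sq j))
    pair-bound i j = ≤-trans (≤-reflexive (trans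
        (∑-cong Q (λ e → regroup (1ℚ - δ i j) (χ e i) (sq i) (χ e j) (sq j)))
        (trans (∑-* ((1ℚ - δ i j) * (sq i * sq j)) (λ e → χ e i * χ e j) Q)
               (cong ((1ℚ - δ i j) * (sq i * sq j) *_) (∑χχ i j)))))
      (weighted i j (codeg Q i j) (codeg≤2 i j))

-- The two largest weights.

maximal : ∀ {m} (y : Fin (suc m) → ℚ) → ∃ λ u → ∀ i → y i ≤ y u
maximal {m} y = argmax y zero (allFin (suc m)) ,
  λ i → All.lookup (f[xs]≤f[argmax] {f = y} zero (allFin (suc m))) (∈-allFin i)
  where open import Data.List.Extrema (DecTotalOrder.totalOrder ≤-decTotalOrder) using (argmax; f[xs]≤f[argmax])

-- The two largest weights are encoded by a matching: any two distinct vertices can be assigned to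
-- `u` and `v` so that neither outweighs its partner. This bounds sums and products of two weights
-- alike.
record TopPair {n} (y : Fin n → ℚ) (u v : Fin n) : Set where
  field
    u≢v       : u ≢ v
    ≤u        : ∀ i → y i ≤ y u
    dominates : ∀ i j → i ≢ j → (y i ≤ y u × y j ≤ y v) ⊎ (y j ≤ y u × y i ≤ y v)

  sum-≤ : ∀ i j → i ≢ j → y i + y j ≤ y u + y v
  sum-≤ i j i≢j with dominates i j i≢j
  ... | inj₁ (i≤u , j≤v) = +-mono-≤ i≤u j≤v
  ... | inj₂ (j≤u , i≤v) = subst (_≤ y u + y v) (+-comm (y j) (y i)) (+-mono-≤ j≤u i≤v)

  product-≤ : (∀ i → 0ℚ ≤ y i) → ∀ i j → i ≢ j → y i * y j ≤ y u * y v
  product-≤ 0≤y i j i≢j with dominates i j i≢j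
  ... | inj₁ (i≤u , j≤v) = *-mono-≤ (0≤y i) (0≤y v) i≤u j≤v
  ... | inj₂ (j≤u , i≤v) = subst (_≤ y u * y v) (*-comm (y j) (y i)) (*-mono-≤ (0≤y j) (0≤y v) j≤u i≤v)

mkTopPair : ∀ {m} (y : Fin (suc m) → ℚ) {u v} → (∀ i → y i ≤ y u) →
  (∀ i → y (punchIn u i) ≤ y (punchIn u v)) → TopPair y u (punchIn u v)
mkTopPair y {u} {v} ≤u ≤v = record
  { u≢v       = λ u≡v → punchInᵢ≢i u v (sym u≡v)
  ; ≤u        = ≤u
  ; dominates = dominates
  }
  where
  others≤v : ∀ i → u ≢ i → y i ≤ y (punchIn u v)
  others≤v i u≢i = subst (λ i → y i ≤ y (punchIn u v)) (punchIn-punchOut u≢i) (≤v (punchOut u≢i))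
  dominates : ∀ i j → i ≢ j → (y i ≤ y u × y j ≤ y (punchIn u v)) ⊎ (y j ≤ y u × y i ≤ y (punchIn u v))
  dominates i j i≢j with u ≟ᶠ i
  ... | yes refl = inj₁ (≤u i , others≤v j i≢j)
  ... | no u≢i  = inj₂ (≤u j , others≤v i u≢i)

topPair : ∀ {m} (y : Fin (suc (suc m)) → ℚ) → ∃₂ (TopPair y)
topPair y =
  let u , ≤u = maximal y
      v , ≤v = maximal (y ∘ punchIn u)
  in u , punchIn u v , mkTopPair y ≤u ≤v

-- The estimate 4 s q ≤ M (s² - M) for a nonnegative weighting.

module _ {n} (y : Fin n → ℚ) (0≤y : ∀ i → 0ℚ ≤ y i) where

  private
    V = allFin n
    s = ∑ V y
    M = ∑[ i ∈ V ] (y i * y i)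
    C = ∑[ i ∈ V ] (y i * y i * (y i * y i))

  0≤s : 0ℚ ≤ s
  0≤s = 0≤∑ V 0≤y

  0≤M : 0ℚ ≤ M
  0≤M = 0≤∑ V (λ i → 0≤p² (y i))

  M≤max*s : ∀ {a} → (∀ i → y i ≤ a) → M ≤ a * s
  M≤max*s {a} y≤a = subst (M ≤_) (∑-* a y V)
    (∑-mono (All.universal (λ i → *-mono-≤ (0≤y i) (0≤y i) (y≤a i) ≤-refl) V))

  M≤s² : M ≤ s * s
  M≤s² = M≤max*s (term≤∑ y 0≤y)

  0<s⇒0<M : 0ℚ < s → 0ℚ < M
  0<s⇒0<M 0<s with 0ℚ <? M
  ... | yes 0<M = 0<M
  ... | no  0≮M = ⊥-elim (<-irrefl refl (<-≤-trans 0<s (subst (s ≤_) (∑-zero V) (∑-mono (All.universal y≤0 V)))))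
    where
    y≤0 : ∀ i → y i ≤ 0ℚ
    y≤0 i = ≮⇒≥ λ 0<yi → 0≮M (<-≤-trans (0<p*q 0<yi 0<yi) (term≤∑ (λ i → y i * y i) (λ i → 0≤p² (y i)) i))

  -- Jensen's inequality for the cube with probabilities yᵢ / s: the mean of yᵢ is M / s and the
  -- mean of yᵢ³ is C / s. Summing `power-tangent` leaves 3 s M³ - 2 s M³ on the left.
  M³≤s²C : 0ℚ < s → M * M * M ≤ s * s * C
  M³≤s²C 0<s = *-cancelˡ-≤ 0<s (begin
    s * (M * M * M)
      ≡⟨ eq₁ s M ⟩
    # 3 * (M * M) * s * M + - (# 2 * (M * M * M)) * s
      ≡⟨ ∑-lin (# 3 * (M * M) * s) (- (# 2 * (M * M * M))) (λ i → y i * y i) y V ⟨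
    ∑[ i ∈ V ] (# 3 * (M * M) * s * (y i * y i) + - (# 2 * (M * M * M)) * y i)
      ≡⟨ ∑-cong V (λ i → eq₂ (# 3 * (M * M) * s * (y i * y i)) (# 2 * (M * M * M)) (y i)) ⟩
    ∑[ i ∈ V ] (# 3 * (M * M) * s * (y i * y i) - # 2 * (M * M * M) * y i)
      ≤⟨ ∑-mono (All.universal (λ i → power-tangent 0≤s 0≤M (0≤y i)) V) ⟩
    ∑[ i ∈ V ] (s * s * s * (y i * y i * (y i * y i)))
      ≡⟨ ∑-* (s * s * s) (λ i → y i * y i * (y i * y i)) V ⟩
    s * s * s * C
      ≡⟨ eq₃ s C ⟩
    s * (s * s * C) ∎)
    where
    open ≤-Reasoning
    eq₁ : ∀ s M → s * (M * M * M) ≡ # 3 * (M * M) * s * M + - (# 2 * (M * M * M)) * s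
    eq₁ = solve-∀ ring
    eq₂ : ∀ p q r → p + - q * r ≡ p - q * r
    eq₂ = solve-∀ ring
    eq₃ : ∀ s C → s * s * s * C ≡ s * (s * s * C)
    eq₃ = solve-∀ ring

  module _ {Q : List (Triple n)} (sorted-Q : All Sorted Q) (sparse : Sparse Q)
           (codeg≤2 : MaxCodegAtMost Q 2) {u v : Fin n} (top : TopPair y u v) where

    open TopPair top

    private
      a = y u
      b = y v
      d = a + b
      q = ∑ Q (edgeProduct y)
      T = ∑ Q (minimum y)
      E = ∑ Q (edgePairSquares y)

      T≤ : T ≤ s - d
      T≤ = sparse-bound Q sparse u≢v y 0≤y

      -- Whichever vertex is the smallest, the other two are distinct, so the product of their
      -- weights is at most a b.
      edge-product-≤ : ∀ e → Sorted e → edgeProduct y e ≤ a * b * minimum y e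
      edge-product-≤ e@(i , j , k) (i<j , j<k) = minimum-elim y (λ w → edgeProduct y e ≤ a * b * w) e
        (bound j k i (Fin.<⇒≢ j<k) (rotate (y i) (y j) (y k)))
        (bound i k j (Fin.<⇒≢ (Fin.<-trans i<j j<k)) (swap (y i) (y j) (y k)))
        (bound i j k (Fin.<⇒≢ i<j) refl)
        where
        bound : ∀ i j k → i ≢ j → edgeProduct y e ≡ y i * y j * y k → edgeProduct y e ≤ a * b * y k
        bound i j k i≢j eq = ≤-trans (≤-reflexive eq)
          (*-monoʳ-≤-nonNeg (y k) {{nonNegative (0≤y k)}} (product-≤ 0≤y i j i≢j))
        rotate : ∀ p q r → p * q * r ≡ q * r * p
        rotate = solve-∀ ring
        swap : ∀ p q r → p * q * r ≡ p * r * q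
        swap = solve-∀ ring

      q≤ab[s-d] : q ≤ a * b * (s - d)
      q≤ab[s-d] = begin
        q                                  ≤⟨ ∑-mono (All.map (λ {e} → edge-product-≤ e) sorted-Q) ⟩
        ∑[ e ∈ Q ] (a * b * minimum y e)   ≡⟨ ∑-* (a * b) (minimum y) Q ⟩
        a * b * T                          ≤⟨ *-monoˡ-≤ (0≤p*q (0≤y u) (0≤y v)) T≤ ⟩
        a * b * (s - d)                    ∎
        where open ≤-Reasoning

      -- `edge-bound` distinguishes its third argument; both sides are otherwise symmetric, so
      -- permuting the edge allows each vertex in that place.
      edge-bound-≤ : # 4 * M ≤ s * s → ∀ e → Sorted e →
        # 4 * (s * s) * M * edgeProduct y e
          ≤ (s * s - M) * (M * M) * minimum y e + s * s * d * edgePairSquares y e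
      edge-bound-≤ 4M≤s² e@(i , j , k) (i<j , j<k) = minimum-elim y
        (λ w → # 4 * (s * s) * M * edgeProduct y e ≤ (s * s - M) * (M * M) * w + s * s * d * edgePairSquares y e) e
        (bound j k i (Fin.<⇒≢ j<k) (rotate (y i) (y j) (y k)) (rotate² (y i) (y j) (y k)))
        (bound i k j (Fin.<⇒≢ (Fin.<-trans i<j j<k)) (swap (y i) (y j) (y k)) (swap² (y i) (y j) (y k)))
        (bound i j k (Fin.<⇒≢ i<j) refl refl)
        where
        bound : ∀ i j k → i ≢ j → y i * y j * y k ≡ edgeProduct y e →
          pairSquares (y i) (y j) (y k) ≡ edgePairSquares y e →
          # 4 * (s * s) * M * edgeProduct y e ≤ (s * s - M) * (M * M) * y k + s * s * d * edgePairSquares y e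
        bound i j k i≢j eq₁ eq₂ = subst₂
          (λ p r → # 4 * (s * s) * M * p ≤ (s * s - M) * (M * M) * y k + s * s * d * r) eq₁ eq₂
          (edge-bound (0≤y i) (0≤y j) (0≤y k) (sum-≤ i j i≢j) {s} {M} 4M≤s²)
        rotate : ∀ p q r → q * r * p ≡ p * q * r
        rotate = solve-∀ ring
        swap : ∀ p q r → p * r * q ≡ p * q * r
        swap = solve-∀ ring
        rotate² : ∀ p q r → q * q * (r * r) + (q * q * (p * p) + r * r * (p * p))
                          ≡ p * p * (q * q) + (p * p * (r * r) + q * q * (r * r))
        rotate² = solve-∀ ring
        swap² : ∀ p q r → p * p * (r * r) + (p * p * (q * q) + r * r * (q * q))
                        ≡ p * p * (q * q) + (p * p * (r * r) + q * q * (r * r))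
        swap² = solve-∀ ring

      summed-edge-bound : # 4 * M ≤ s * s →
        # 4 * (s * s) * M * q ≤ (s * s - M) * (M * M) * T + s * s * d * E
      summed-edge-bound 4M≤s² = subst₂ _≤_
        (∑-* (# 4 * (s * s) * M) (edgeProduct y) Q)
        (∑-lin ((s * s - M) * (M * M)) (s * s * d) (minimum y) (edgePairSquares y) Q)
        (∑-mono (All.map (λ {e} → edge-bound-≤ 4M≤s² e) sorted-Q))

    edge-sum-bound : 0ℚ < s → # 4 * s * q ≤ M * (s * s - M)
    edge-sum-bound 0<s with ≤-total (# 4 * M) (s * s)
    ... | inj₂ s²≤4M = concentrated-bound 0≤s (0≤y u) (term≤∑ y 0≤y u) (M≤max*s ≤u) s²≤4M q≤ab[s-d]
    ... | inj₁ 4M≤s² = spread-bound 0<s (0<s⇒0<M 0<s) (0≤p+q (0≤y u) (0≤y v)) M≤s² (M³≤s²C 0<s) T≤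
      (codegree-bound y sorted-Q codeg≤2) (summed-edge-bound 4M≤s²)

  -- A top pair requires at least two vertices. An edge supplies them, and without edges the left
  -- side is zero.
  lagrangian-bound : ∀ {Q : List (Triple n)} → All Sorted Q → Sparse Q → MaxCodegAtMost Q 2 →
    0ℚ < s → # 4 * s * ∑ Q (edgeProduct y) ≤ M * (s * s - M)
  lagrangian-bound [] _ _ _ = subst (_≤ M * (s * s - M)) (sym (*-zeroʳ (# 4 * s))) (0≤p*q 0≤M (0≤q-p M≤s²))
  lagrangian-bound sorted-Q@(_∷_ {x = i , j , k} (i<j , _) _) sparse codeg≤2 0<s =
    let _ , _ , top = pair i j i<j in edge-sum-bound sorted-Q sparse codeg≤2 top 0<s
    where
    pair : ∀ {n} {y : Fin n → ℚ} (i j : Fin n) → i Fin.< j → ∃₂ (TopPair y)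
    pair {suc (suc m)} {y} _ _ _ = topPair y
    pair {suc zero} zero zero ()

-- The cone polynomial and the final bound.

∑-if : ∀ {A : Set} b (x : A) (f : A → ℚ) → ∑ (if b then [ x ] else []) f ≡ ⟦ b ⟧ * f x
∑-if true  x f = trans (+-identityʳ (f x)) (sym (*-identityˡ (f x)))
∑-if false x f = sym (*-zeroˡ (f x))

-- The apex edges contribute a P, where P sums yᵢ yⱼ over i < j. Trichotomy of indices gives s² = 2
-- P + M, so 6 a P = 3 a (s² - M).
lagPoly-cone : ∀ {n} (Q : List (Triple n)) (x : Fin (suc n) → ℚ) →
  let y = x ∘ suc; s = ∑ (allFin n) y; M = ∑[ i ∈ allFin n ] (y i * y i) in
  lagPoly (coneEdges Q) x ≡ # 3 * x zero * (s * s - M) + # 6 * ∑ Q (edgeProduct y)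
lagPoly-cone {n} Q x = begin
  lagPoly (coneEdges Q) x
    ≡⟨ cong (# 6 *_) (trans (∑-++ _ (map _ Q) _) (cong₂ _+_ base apex)) ⟩
  # 6 * (q + a * P)
    ≡⟨ eq a P M q ⟩
  # 3 * a * ((P + (P + M)) - M) + # 6 * q
    ≡⟨ cong (λ r → # 3 * a * (r - M) + # 6 * q) s² ⟨
  # 3 * a * (s * s - M) + # 6 * q ∎
  where
  open ≡-Reasoning
  V = allFin n
  a = x zero
  y = x ∘ suc
  s = ∑ V y
  M = ∑[ i ∈ V ] (y i * y i)
  q = ∑ Q (edgeProduct y)
  lt : Fin n → Fin n → ℚ
  lt i j = ⟦ ⌊ i Fin.<? j ⌋ ⟧
  P = ∑[ i ∈ V ] ∑[ j ∈ V ] (lt i j * (y i * y j))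
  base = trans (∑-map _ _ Q) (∑-cong Q (λ _ → refl))
  apex = trans (∑-concatMap _ _ V) (trans (∑-cong V (λ i → trans (∑-concatMap _ _ V)
           (trans (∑-cong V (λ j → trans (∑-if ⌊ i Fin.<? j ⌋ _ _) (regroup (lt i j) a (y i) (y j)))) (∑-* a (λ j → lt i j * (y i * y j)) V))))
         (∑-* a (λ i → ∑[ j ∈ V ] (lt i j * (y i * y j))) V))
    where
    regroup : ∀ l a p q → l * (a * p * q) ≡ a * (l * (p * q))
    regroup = solve-∀ ring
  trichotomy : ∀ i j → lt i j + (lt j i + δ i j) ≡ 1ℚ
  trichotomy i j with i Fin.<? j | j Fin.<? i | i ≟ᶠ j
  ... | yes i<j | yes j<i | _        = ⊥-elim (Fin.<-asym i<j j<i)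
  ... | yes i<j | no _    | yes i≡j  = ⊥-elim (Fin.<⇒≢ i<j i≡j)
  ... | yes _   | no _    | no _     = refl
  ... | no _    | yes j<i | yes i≡j  = ⊥-elim (Fin.<⇒≢ j<i (sym i≡j))
  ... | no _    | yes _   | no _     = refl
  ... | no _    | no _    | yes _    = refl
  ... | no i≮j  | no j≮i  | no i≢j with Fin.<-cmp i j
  ...   | tri< i<j _ _ = ⊥-elim (i≮j i<j)
  ...   | tri≈ _ i≡j _ = ⊥-elim (i≢j i≡j)
  ...   | tri> _ _ j<i = ⊥-elim (j≮i j<i)
  s² : s * s ≡ P + (P + M)
  s² = begin
    s * s
      ≡⟨ ∑*∑ y y V V ⟩
    ∑[ i ∈ V ] ∑[ j ∈ V ] (y i * y j)
      ≡⟨ ∑-cong V (λ i → ∑-cong V (λ j → split i j)) ⟩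
    ∑[ i ∈ V ] ∑[ j ∈ V ] (lt i j * (y i * y j) + (lt j i * (y j * y i) + δ i j * (y i * y j)))
      ≡⟨ ∑-cong V (λ i → trans (∑-+ (λ j → lt i j * (y i * y j)) (λ j → lt j i * (y j * y i) + δ i j * (y i * y j)) V)
           (+-congˡ (∑[ j ∈ V ] (lt i j * (y i * y j)))
             (trans (∑-+ (λ j → lt j i * (y j * y i)) (λ j → δ i j * (y i * y j)) V)
                    (+-congˡ (∑[ j ∈ V ] (lt j i * (y j * y i))) (∑-δ i (λ j → y i * y j)))))) ⟩
    ∑[ i ∈ V ] ((∑[ j ∈ V ] (lt i j * (y i * y j))) + ((∑[ j ∈ V ] (lt j i * (y j * y i))) + y i * y i))
      ≡⟨ trans (∑-+ (λ i → ∑[ j ∈ V ] (lt i j * (y i * y j))) (λ i → (∑[ j ∈ V ] (lt j i * (y j * y i))) + y i * y i) V)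
           (+-congˡ P (∑-+ (λ i → ∑[ j ∈ V ] (lt j i * (y j * y i))) (λ i → y i * y i) V)) ⟩
    P + ((∑[ i ∈ V ] ∑[ j ∈ V ] (lt j i * (y j * y i))) + M)
      ≡⟨ cong (λ r → P + (r + M)) (∑-comm (λ i j → lt j i * (y j * y i)) V V) ⟩
    P + (P + M) ∎
    where
    expand : ∀ l m d p q → (l + (m + d)) * (p * q) ≡ l * (p * q) + (m * (q * p) + d * (p * q))
    expand = solve-∀ ring
    split : ∀ i j → y i * y j ≡ lt i j * (y i * y j) + (lt j i * (y j * y i) + δ i j * (y i * y j))
    split i j = trans (sym (*-identityˡ (y i * y j)))
      (trans (cong (_* (y i * y j)) (sym (trichotomy i j))) (expand (lt i j) (lt j i) (δ i j) (y i) (y j)))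
  eq : ∀ a P M q → # 6 * (q + a * P) ≡ # 3 * a * ((P + (P + M)) - M) + # 6 * q
  eq = solve-∀ ring

theorem3p1 : (n : ℕ) (Q : ThreeGraph n) →
    Sparse (edges Q) → MaxCodegAtMost (edges Q) 2 →
    (x : Fin (suc n) → ℚ) → (∀ i → 0ℚ ≤ x i) → sumFin x ≡ 1ℚ →
    lagPoly (coneEdges (edges Q)) x ≤ (+ 4) / 9
theorem3p1 n Q sparse codeg≤2 x 0≤x ∑x≡1 =
  subst (_≤ + 4 / 9) (sym (lagPoly-cone (edges Q) x)) (bound (0ℚ <? s))
  where
  y = x ∘ suc
  s = ∑ (allFin n) y
  M = ∑[ i ∈ allFin n ] (y i * y i)
  q = ∑ (edges Q) (edgeProduct y)
  bound : Dec (0ℚ < s) → # 3 * x zero * (s * s - M) + # 6 * q ≤ + 4 / 9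
  bound (yes 0<s) = cone-bound (0≤x zero) 0<s (trans (sym (∑-allFin-suc x)) ∑x≡1)
                    (lagrangian-bound y (0≤x ∘ suc) (sorted Q) sparse codeg≤2 0<s)
  -- `cone-bound` divides by s, so s = 0 is treated apart: all weight sits on the apex and every
  -- edge product is zero.
  bound (no 0≮s)  = ≤-trans (≤-reflexive vanishing) (nonNegative⁻¹ (+ 4 / 9))
    where
    open ≡-Reasoning
    y≡0 : ∀ i → y i ≡ 0ℚ
    y≡0 i = ≤-antisym (≤-trans (term≤∑ y (0≤x ∘ suc) i) (≮⇒≥ 0≮s)) (0≤x (suc i))
    s≡0 : s ≡ 0ℚ
    s≡0 = trans (∑-cong (allFin n) y≡0) (∑-zero (allFin n))
    M≡0 : M ≡ 0ℚ
    M≡0 = trans (∑-cong (allFin n) (λ i → cong₂ _*_ (y≡0 i) (y≡0 i))) (∑-zero (allFin n))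
    q≡0 : q ≡ 0ℚ
    q≡0 = trans (∑-cong (edges Q) (λ (i , j , k) → cong₂ _*_ (cong₂ _*_ (y≡0 i) (y≡0 j)) (y≡0 k))) (∑-zero (edges Q))
    vanishing : # 3 * x zero * (s * s - M) + # 6 * q ≡ 0ℚ
    vanishing = begin
      # 3 * x zero * (s * s - M) + # 6 * q
        ≡⟨ cong₂ (λ p r → # 3 * x zero * p + # 6 * r) (cong₂ _-_ (cong₂ _*_ s≡0 s≡0) M≡0) q≡0 ⟩
      # 3 * x zero * 0ℚ + # 6 * 0ℚ
        ≡⟨ cong (_+ # 6 * 0ℚ) (*-zeroʳ (# 3 * x zero)) ⟩
      0ℚ ∎
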